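{- Let $r,m\in\mathbb N$ and let $\mathbb N=\bigcup_{i=1}^r E_i$. Suppose that for each $i\in\{1,2,\dots,m\}$, $A_i$ is a $u_i\times v_i$ image partition regular matrix over $(\mathbb N,+)$ with rational entries, where $u_i,v_i\in\mathbb N$. Then there exist $k\in\{1,2,\dots,r\}$, vectors $\vec{x}^{(i)},\vec{y}^{(i)}\in\mathbb N^{v_i}$ for $i\in\{1,2,\dots,m\}$, and a sequence $\{z_t\}_{t=1}^\infty$ in $\mathbb N$ such that $A_i\vec{x}^{(i)}\in E_k^{u_i}$ for each $i\in\{1,2,\dots,m\}$, $P(A_1\vec{y}^{(1)},A_2\vec{y}^{(2)},\dots,A_m\vec{y}^{(m)})\subseteq E_k$, and $PS_m(\{z_t\}_{t=1}^\infty)\subseteq E_k$.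
   Context: $\mathbb N=\{1,2,3,\dots\}$; $\mathcal P_f(\mathbb N)$ is the set of finite nonempty subsets of $\mathbb N$. A matrix $A$ with rational entries is image partition regular (over $(\mathbb N,+)$) if whenever $\mathbb N$ is finitely colored there is a vector $\vec x$ with entries from $\mathbb N$ such that all entries of $A\vec x$ lie in one color class. For vectors $\vec w^{(1)},\dots,\vec w^{(m)}$ with entries from $\mathbb N$, $P(\vec w^{(1)},\dots,\vec w^{(m)})=\{\prod_{i=1}^m w_i: w_i \text{ is an entry of } \vec w^{(i)} \text{ for each } i=1,\dots,m\}$. For a sequence $\{z_t\}_{t=1}^\infty$ in $\mathbb N$, $PS_m(\{z_t\}_{t=1}^\infty)=\{\prod_{i=1}^m\sum_{t\in F_i}z_t: F_1,\dots,F_m\in\mathcal P_f(\mathbb N)\text{ and }\max F_i<\min F_{i+1}\text{ for all } i=1,\dots,m-1\}$. -}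

module Defs where

open import Data.Fin.Base using (Fin; toℕ)
open import Data.Integer.Base using (+_)
open import Data.List.Base using (map; sum)
open import Data.List.NonEmpty.Base using (List⁺; toList; foldr₁)
open import Data.List.Relation.Unary.All using (All)
open import Data.List.Relation.Unary.AllPairs using (AllPairs)
open import Data.Nat.Base using (ℕ; suc; _<_; _⊔_; _⊓_; NonZero; +-*-rawSemiring)
open import Data.Product.Base using (∃-syntax; Σ-syntax; _×_)
open import Data.Rational.Base using (ℚ; _/_) renaming (_*_ to _*ℚ_; +-0-rawMonoid to ℚ-+-rawMonoid)
open import Data.Vec.Functional using (Vector)
open import Level using (0ℓ)
open import Relation.Binary.PropositionalEquality using (_≡_)
open import Relation.Unary using (Pred; _∈_)

open import Algebra.Definitions.RawMonoid ℚ-+-rawMonoid using () renaming (sum to sumℚ)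
open import Algebra.Definitions.RawSemiring +-*-rawSemiring using () renaming (product to ∏)

-- The set {1, 2, 3, …}.  Its subsets are predicates on ℕ contained in ℕ₊, so
-- that sums and products are those of ℕ.
ℕ₊ : Pred ℕ 0ℓ
ℕ₊ = NonZero

_^ᵛ_ : Pred ℕ 0ℓ → (u : ℕ) → Pred (Vector ℕ u) 0ℓ
(S ^ᵛ u) x = ∀ j → x j ∈ S

ι : ℕ → ℚ
ι n = + n / 1

Matrix : ℕ → ℕ → Set
Matrix u v = Vector (Vector ℚ v) u

_·_ : ∀ {u v} → Matrix u v → Vector ℕ v → Vector ℚ u
(A · x) i = sumℚ (λ j → A i j *ℚ ι (x j))

_≈ι_ : ∀ {u} → Vector ℚ u → Vector ℕ u → Set
q ≈ι w = ∀ j → q j ≡ ι (w j)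

-- q ∈ Sᵘ, for a rational vector q and a set S of naturals.
_∈ι_ : ∀ {u} → Vector ℚ u → Pred ℕ 0ℓ → Set
_∈ι_ {u} q S = ∃[ w ] w ∈ S ^ᵛ u × q ≈ι w

-- A colouring of {1, 2, …} is given by c on ℕ; the colour of 0 is never used.
colourClass : ∀ {r} → (ℕ → Fin r) → Fin r → Pred ℕ 0ℓ
colourClass c k n = n ∈ ℕ₊ × c n ≡ k

ImagePartitionRegular : ∀ {u v} → Matrix u v → Set
ImagePartitionRegular {u} {v} A =
  ∀ {r} (c : ℕ → Fin r) →
  ∃[ x ] x ∈ ℕ₊ ^ᵛ v × ∃[ k ] (A · x) ∈ι colourClass c k

P : ∀ {m} {u : Fin m → ℕ} → (∀ i → Vector ℕ (u i)) → Pred ℕ 0ℓ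
P {u = u} w n = Σ[ f ∈ (∀ i → Fin (u i)) ] n ≡ ∏ (λ i → w i (f i))

-- Finite nonempty subsets of {1, 2, …}; each is given by the list of its
-- elements in increasing order.
record FiniteNonempty : Set where
  field
    elements   : List⁺ ℕ
    positive   : All ℕ₊ (toList elements)
    increasing : AllPairs _<_ (toList elements)

  max min : ℕ
  max = foldr₁ _⊔_ elements
  min = foldr₁ _⊓_ elements

  ∑ : (ℕ → ℕ) → ℕ
  ∑ z = sum (map z (toList elements))

open FiniteNonempty using (max; min; ∑)

-- A sequence (z_t), t ≥ 1, is given by z on ℕ; the value z 0 is never used.
PS : (m : ℕ) → (ℕ → ℕ) → Pred ℕ 0ℓ
PS m z n =
  Σ[ F ∈ (Fin m → FiniteNonempty) ]
    (∀ (i j : Fin m) → toℕ j ≡ suc (toℕ i) → max (F i) < min (F j)) ×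
    n ≡ ∏ (λ i → ∑ (F i) z)

{-# OPTIONS --safe #-}
module Submission where

-- Work with subsets of ℕ that are Ramsey, i.e. such that every finite colouring has a
-- monochromatic joint image of A₁, …, A_m inside the subset.  By compactness and
-- multiplicative scaling ℕ is Ramsey.  A condition is a decreasing sequence of Ramsey sets
-- B₀ ⊇ B₁ ⊇ … with x + B_{k+x} ⊆ B_k for x ∈ B_k: a countably generated stand-in for an
-- idempotent ultrafilter.
--
-- Every condition can be refined so that a given colouring c is constant on a member, by
-- an Ellis argument in the space of colourings: let Lim C c y say that y is a limit of
-- shifts of c along C.  Refine C until the set of limits of c is minimal, find a limit y of
-- c with Lim C y y, restrict to the n whose shift fixes y (by minimality y remains a limit
-- of c), and then to the n whose shift takes c to y.
--
-- Deciding all colourings n ↦ c (a * n), then doing the same to the resulting limit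
-- colouring a ↦ lim_n c (a * n), and so on m times, gives a single colour k such that
-- c (n₁ ⋯ n_m) = k whenever each n_i lies in a member of the condition deep enough in terms
-- of n₁ ⋯ n_{i-1}.  Images of the A_i and finite sums of a sufficiently fast sequence can
-- both serve as the n_i; scaling the image chosen for n₁ by fixed n₂ ⋯ n_m gives the x⁽ⁱ⁾.

open import Defs
open import Algebra.Bundles using (CommutativeRing)
open import Axiom.ExcludedMiddle using (ExcludedMiddle)
open import Data.Bool.Base using (Bool; T)
open import Data.Empty using (⊥-elim)
open import Data.Fin.Base using (Fin; zero; suc; toℕ; fromℕ<; combine; inject≤; funToFin; finToFun)
open import Data.Fin.Properties
  using (toℕ-fromℕ<; toℕ<n; toℕ-injective; finToFun-funToFin; combine-injectiveˡ; combine-injectiveʳ; inject≤-injective)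
open import Data.Integer.Base using (+_)
import Data.Integer.Base as ℤ
import Data.Integer.Properties as ℤ
open import Data.List.Base using ([]; _∷_; map)
open import Data.List.NonEmpty.Base using (foldr₁) renaming (_∷_ to _∷⁺_)
open import Data.List.Relation.Unary.All using (_∷_)
open import Data.List.Relation.Unary.AllPairs using (AllPairs; _∷_)
open import Data.Nat.Base
open import Data.Nat.ListAction using (sum)
open import Data.Nat.Properties
open import Data.Product.Base using (Σ; Σ-syntax; ∃-syntax; _×_; _,_; proj₁; proj₂)
open import Data.Rational.Base using (toℚᵘ) renaming (_+_ to _+ℚ_; _*_ to _*ℚ_)
open import Data.Rational.Properties using (toℚᵘ-injective; toℚᵘ-fromℚᵘ; toℚᵘ-homo-+; toℚᵘ-homo-*; +-*-commutativeRing)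
import Data.Rational.Properties as ℚ
open import Data.Rational.Unnormalised.Base using (mkℚᵘ; _≃_; *≡*)
import Data.Rational.Unnormalised.Base as ℚᵘ
import Data.Rational.Unnormalised.Properties as ℚᵘ
open import Data.Sum.Base using (inj₁; inj₂)
open import Data.Unit.Base using (⊤; tt)
open import Data.Vec.Functional using (Vector) renaming (_∷_ to _∷ᵛ_)
open import Function.Base using (_∘_; id)
open import Level using (0ℓ)
open import Relation.Binary.PropositionalEquality
open import Relation.Nullary using (Dec; yes; no; ¬_; contradiction)
open import Relation.Nullary.Decidable using (⌊_⌋; toWitness; fromWitness; decidable-stable)
open import Relation.Unary using (Pred; _∈_; _⊆_; _≐_; ⋃)

open import Algebra.Definitions.RawSemiring +-*-rawSemiring using () renaming (product to ∏)
open import Algebra.Properties.CommutativeMonoid.Sum ℚ.+-0-commutativeMonoid using (∑-distrib-+; sum-cong-≗)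
open import Algebra.Properties.Semiring.Sum (CommutativeRing.semiring +-*-commutativeRing) using (*-distribˡ-sum)

-- Bounds, shifts and prefixes of colourings, an enumeration of pairs.

upperBound : ∀ {n} (f : Fin n → ℕ) → ∃[ N ] (∀ i → f i ≤ N)
upperBound {zero}  f = 0 , λ ()
upperBound {suc n} f with upperBound (f ∘ suc)
... | N , f≤N = f zero ⊔ N , λ where
  zero    → m≤m⊔n (f zero) N
  (suc i) → ≤-trans (f≤N i) (m≤n⊔m (f zero) N)

upperBound≤ : (f : ℕ → ℕ) (M : ℕ) → ∃[ N ] (∀ {a} → a ≤ M → f a ≤ N)
upperBound≤ f M with upperBound {suc M} (f ∘ toℕ)
... | N , f≤N = N , λ a≤M →
  subst (λ b → f b ≤ N) (toℕ-fromℕ< (s≤s a≤M)) (f≤N (fromℕ< (s≤s a≤M)))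

Agree : {A : Set} → ℕ → (ℕ → A) → (ℕ → A) → Set
Agree k y z = ∀ {i} → i < k → y i ≡ z i

shift : {A : Set} → ℕ → (ℕ → A) → ℕ → A
shift n z i = z (n + i)

-- Shifting `v` by `x` uses up `x` places, so `shift y u` must follow `v` for `k + x` places. The
-- `k + x` in `Condition.add` matches this.
shift-agree : {A : Set} {k x y : ℕ} (u v w : ℕ → A) →
  Agree k (shift x v) w → Agree (k + x) (shift y u) v → Agree k (shift (x + y) u) w
shift-agree {k = k} {x} {y} u v w vw uv {i} i<k = begin
  u (x + y + i)    ≡⟨ cong (λ n → u (n + i)) (+-comm x y) ⟩
  u (y + x + i)    ≡⟨ cong u (+-assoc y x i) ⟩
  u (y + (x + i))  ≡⟨ uv (subst (x + i <_) (+-comm x k) (+-monoʳ-< x i<k)) ⟩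
  v (x + i)        ≡⟨ vw i<k ⟩
  w i              ∎
  where open ≡-Reasoning

funToFin-cong : ∀ {m n} {f g : Fin m → Fin n} → (∀ i → f i ≡ g i) → funToFin f ≡ funToFin g
funToFin-cong {zero}  eq = refl
funToFin-cong {suc m} eq = cong₂ combine (eq zero) (funToFin-cong (eq ∘ suc))

prefix : ∀ {r} (k : ℕ) → (ℕ → Fin r) → Fin (r ^ k)
prefix k z = funToFin {k} (z ∘ toℕ)

prefix-≡ : ∀ {r} k {y z : ℕ → Fin r} → Agree k y z → prefix k y ≡ prefix k z
prefix-≡ k {y} {z} eq = funToFin-cong {k} (λ i → eq (toℕ<n i))

prefix-agree : ∀ {r} k (y z : ℕ → Fin r) → prefix k y ≡ prefix k z → Agree k y z
prefix-agree k y z eq {i} i<k = begin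
  y i                                   ≡⟨ cong y (toℕ-fromℕ< i<k) ⟨
  y (toℕ (fromℕ< i<k))                  ≡⟨ finToFun-funToFin {k} (y ∘ toℕ) (fromℕ< i<k) ⟨
  finToFun (prefix k y) (fromℕ< i<k)    ≡⟨ cong (λ c → finToFun c (fromℕ< i<k)) eq ⟩
  finToFun (prefix k z) (fromℕ< i<k)    ≡⟨ finToFun-funToFin {k} (z ∘ toℕ) (fromℕ< i<k) ⟩
  z (toℕ (fromℕ< i<k))                  ≡⟨ cong z (toℕ-fromℕ< i<k) ⟩
  z i                                   ∎
  where open ≡-Reasoning

-- Walks along the antidiagonals of `ℕ × ℕ`; from `(0 , b)` it jumps to the start of the following
-- one.
next : ℕ × ℕ → ℕ × ℕ
next (zero  , b) = suc b , zero
next (suc a , b) = a , suc b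

unpair : ℕ → ℕ × ℕ
unpair zero    = 0 , 0
unpair (suc n) = next (unpair n)

unpair-surjective : ∀ a b → ∃[ n ] unpair n ≡ (a , b)
unpair-surjective a b = go (a + b) a b refl
  where
  go : ∀ s a b → a + b ≡ s → ∃[ n ] unpair n ≡ (a , b)
  go s       a       (suc b) eq with go s (suc a) b (trans (sym (+-suc a b)) eq)
  ... | n , p = suc n , cong next p
  go zero    zero    zero    eq = 0 , refl
  go (suc s) (suc a) zero    eq with go s zero a (trans (sym (+-identityʳ a)) (suc-injective eq))
  ... | n , p = suc n , cong next p

-- Shapes and Ramsey sets.

record Shape : Set₁ where
  field
    Index    : Set
    base     : Index
    Image    : (Index → ℕ) → Set
    Image-+  : ∀ {w w′} → Image w → Image w′ → Image (λ j → w j + w′ j)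
    positive : ∀ {w} → Image w → ∀ j → NonZero (w j)

module _ (S : Shape) where
  open Shape S

  Mono : Pred ℕ 0ℓ → ℕ → ∀ {r} → (ℕ → Fin r) → Set
  Mono X N χ = Σ[ w ∈ (Index → ℕ) ] Image w ×
    (∀ j → X (w j)) × (∀ j → w j ≤ N) × (∀ j → χ (w j) ≡ χ (w base))

  -- The bound `N` depends on the number of colours but not on the colouring, so it is available
  -- before any image is chosen.
  record Ramsey (X : Pred ℕ 0ℓ) : Set where
    constructor mkRamsey
    field
      find : ∀ r → ∃[ N ] (∀ (χ : ℕ → Fin r) → Mono X N χ)

  Ramsey-mono : ∀ {X Y : Pred ℕ 0ℓ} → (∀ {n} → X n → Y n) → Ramsey X → Ramsey Y
  Ramsey-mono X⊆Y (mkRamsey find) = mkRamsey λ r → let (N , mono) = find r in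
    N , λ χ → let (w , im , in-X , ≤N , const) = mono χ in w , im , X⊆Y ∘ in-X , ≤N , const

-- The colouring b ↦ (χ a b)_{a ≤ N} makes all rows a ≤ N monochromatic at once.
double : (S S′ : Shape) → let open Shape in ∀ {X : Pred ℕ 0ℓ} {Y : ℕ → Pred ℕ 0ℓ} →
  Ramsey S X → (∀ N → Ramsey S′ (Y N)) → ∀ r →
  ∃[ N ] ∃[ M ] (∀ (χ : ℕ → ℕ → Fin r) →
    Σ[ w ∈ (Index S → ℕ) ] Σ[ w′ ∈ (Index S′ → ℕ) ] Image S w × Image S′ w′ ×
    (∀ j → X (w j)) × (∀ j → Y N (w′ j)) × (∀ j → w j ≤ N) × (∀ j → w′ j ≤ M) ×
    (∀ j j′ → χ (w j) (w′ j′) ≡ χ (w (base S)) (w′ (base S′))))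
double S S′ {X} {Y} RX RY r with Ramsey.find RX r
... | N , monoX with Ramsey.find (RY N) (r ^ suc N)
... | M , monoY = N , M , λ χ →
  let (w′ , im′ , in-Y , ≤M , const′) = monoY (λ b → prefix (suc N) (λ a → χ a b))
      (w  , im  , in-X , ≤N , const)  = monoX (λ a → χ a (w′ (Shape.base S′)))
  in w , w′ , im , im′ , in-X , in-Y , ≤N , ≤M ,
     λ j j′ → trans
       (prefix-agree (suc N) (λ a → χ a (w′ j′)) (λ a → χ a (w′ (Shape.base S′))) (const′ j′) (s≤s (≤N j)))
       (const j)

-- Members are Bool-valued so that conditions form a small type, to which excluded middle
-- at level 0 applies.
record Condition (S : Shape) : Set where
  open Shape S
  field
    member : ℕ → ℕ → Bool
  _∋_ : ℕ → ℕ → Set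
  k ∋ n = T (member k n)
  field
    anti   : ∀ {k l n} → k ≤ l → l ∋ n → k ∋ n
    add    : ∀ {k x y} → k ∋ x → (k + x) ∋ y → k ∋ (x + y)
    ramsey : ∀ k → Ramsey S (k ∋_)

-- Compactness of the space of colourings and partition regularity.

module Classical (em : ExcludedMiddle 0ℓ) where

  ¬∀⇒∃¬ : {A : Set} {P : A → Set} → ¬ (∀ x → P x) → Σ[ x ∈ A ] ¬ P x
  ¬∀⇒∃¬ {A} {P} ¬∀ with em {Σ[ x ∈ A ] ¬ P x}
  ... | yes e = e
  ... | no ¬e = ⊥-elim (¬∀ λ x → decidable-stable em λ ¬p → ¬e (x , ¬p))

  pigeonhole-∞ : ∀ {r} (f : ℕ → Fin r) → ∃[ l ] (∀ n → ∃[ n′ ] n ≤ n′ × f n′ ≡ l)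
  pigeonhole-∞ {r} f with em {∃[ l ] (∀ n → ∃[ n′ ] n ≤ n′ × f n′ ≡ l)}
  ... | yes e = e
  ... | no ¬e = ⊥-elim (proj₂ (last (f N)) (N , proj₂ bound (f N) , refl))
    where
    last : ∀ l → ∃[ n ] ¬ (∃[ n′ ] n ≤ n′ × f n′ ≡ l)
    last l = ¬∀⇒∃¬ λ h → ¬e (l , h)
    bound = upperBound (proj₁ ∘ last)
    N = proj₁ bound

  -- Sequential compactness: along `sub k` the places below `k` are constant, and the diagonal
  -- `sub k k` is unbounded.
  cluster : ∀ {r} (s : ℕ → ℕ → Fin r) →
    Σ[ χ ∈ (ℕ → Fin r) ] (∀ k → ∃[ n ] k ≤ n × Agree k (s n) χ)
  cluster {r} s = limit , λ k → sub k k , sub-≥ k k , λ {i} → agree k i k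
    where
    sub : ℕ → ℕ → ℕ
    pick : ∀ k → ∃[ l ] (∀ n → ∃[ n′ ] n ≤ n′ × s (sub k n′) k ≡ l)
    sub zero    n = n
    sub (suc k) n = sub k (proj₁ (proj₂ (pick k) n))
    pick k = pigeonhole-∞ (λ n → s (sub k n) k)

    limit : ℕ → Fin r
    limit k = proj₁ (pick k)

    sub-≥ : ∀ k n → n ≤ sub k n
    sub-≥ zero    n = ≤-refl
    sub-≥ (suc k) n = ≤-trans (proj₁ (proj₂ (proj₂ (pick k) n))) (sub-≥ k _)

    agree : ∀ k i n → i < k → s (sub k n) i ≡ limit i
    agree (suc k) i n (s≤s i≤k) with m≤n⇒m<n∨m≡n i≤k
    ... | inj₁ i<k  = agree k i _ i<k
    ... | inj₂ refl = proj₂ (proj₂ (proj₂ (pick k) n))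

  module _ {S : Shape} where
    open Shape S

    -- If every piece fails, each has a bad colouring for every `N`. Colouring `n` by its piece
    -- together with the bad colouring of that piece contradicts the Ramsey property of `X`.
    Ramsey-partition : ∀ {X s} → Ramsey S X → (f : ℕ → Fin s) →
      ∃[ l ] Ramsey S (λ n → X n × f n ≡ l)
    Ramsey-partition {X} {s} RX f with em {∃[ l ] Ramsey S (λ n → X n × f n ≡ l)}
    ... | yes e = e
    ... | no ¬e = ⊥-elim (proj₂ (bad l) N (w , im , (λ j → in-X j , same j) , ≤N , const′))
      where
      fails : ∀ l → ∃[ r ] ¬ (∃[ N ] (∀ (χ : ℕ → Fin r) → Mono S (λ n → X n × f n ≡ l) N χ))
      fails l = ¬∀⇒∃¬ λ h → ¬e (l , mkRamsey h)
      size = proj₁ ∘ fails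
      R = proj₁ (upperBound size)
      size≤R = proj₂ (upperBound size)
      bad : ∀ l → Σ[ χ ∈ (ℕ → ℕ → Fin (size l)) ] (∀ N → ¬ Mono S (λ n → X n × f n ≡ l) N (χ N))
      bad l = (λ N → proj₁ (c N)) , (λ N → proj₂ (c N))
        where
        c : ∀ N → Σ[ χ ∈ (ℕ → Fin (size l)) ] ¬ Mono S (λ n → X n × f n ≡ l) N χ
        c N = ¬∀⇒∃¬ λ h → proj₂ (fails l) (N , h)
      -- Fixed by the number of colours alone, so the bad colourings can be taken at this very `N`.
      N = proj₁ (Ramsey.find RX (s * R))
      colour : ∀ l → ℕ → Fin R
      colour l n = inject≤ (proj₁ (bad l) N n) (size≤R l)
      mono = proj₂ (Ramsey.find RX (s * R)) (λ n → combine (f n) (colour (f n) n))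
      w = proj₁ mono
      im = proj₁ (proj₂ mono)
      in-X = proj₁ (proj₂ (proj₂ mono))
      ≤N = proj₁ (proj₂ (proj₂ (proj₂ mono)))
      const = proj₂ (proj₂ (proj₂ (proj₂ mono)))
      l = f (w base)
      same : ∀ j → f (w j) ≡ l
      same j = combine-injectiveˡ (f (w j)) _ l _ (const j)
      const′ : ∀ j → proj₁ (bad l) N (w j) ≡ proj₁ (bad l) N (w base)
      const′ j = inject≤-injective (size≤R l) (size≤R l) _ _
        (trans (cong (λ l′ → colour l′ (w j)) (sym (same j))) (combine-injectiveʳ (f (w j)) _ l _ (const j)))

-- Conditions, refinement and fusion.

module Conditions (em : ExcludedMiddle 0ℓ) (S : Shape) where
  open Classical em
  open Shape S
  open Condition

  infix 4 _≼_
  record _≼_ (D C : Condition S) : Set where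
    constructor mk≼
    field
      refine : ∀ k → ∃[ l ] (∀ {n} → _∋_ D l n → _∋_ C k n)
  open _≼_

  ≼-refl : ∀ {C} → C ≼ C
  ≼-refl = mk≼ λ k → k , id

  ≼-trans : ∀ {C D E} → E ≼ D → D ≼ C → E ≼ C
  ≼-trans E≼D D≼C = mk≼ λ k →
    let (l , D⊆C) = refine D≼C k ; (i , E⊆D) = refine E≼D l in i , D⊆C ∘ E⊆D

  build : (P : ℕ → ℕ → Set) →
    (∀ {k l n} → k ≤ l → P l n → P k n) →
    (∀ {k x y} → P k x → P (k + x) y → P k (x + y)) →
    (∀ k → Ramsey S (P k)) → Condition S
  build P P-anti P-add P-ramsey = record
    { member = λ k n → ⌊ em {P k n} ⌋
    ; anti   = λ k≤l → fromWitness ∘ P-anti k≤l ∘ toWitness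
    ; add    = λ p q → fromWitness (P-add (toWitness p) (toWitness q))
    ; ramsey = λ k → Ramsey-mono S fromWitness (P-ramsey k)
    }

  restrict : (C : Condition S) (Q : ℕ → ℕ → Set) →
    (∀ {k l n} → k ≤ l → Q l n → Q k n) →
    (∀ {k x y} → _∋_ C k x → Q k x → Q (k + x) y → Q k (x + y)) →
    (∀ k → Ramsey S (λ n → _∋_ C k n × Q k n)) →
    Σ[ D ∈ Condition S ] D ≼ C × (∀ {k n} → _∋_ D k n → Q k n)
  restrict C Q Q-anti Q-add Q-ramsey =
    build (λ k n → _∋_ C k n × Q k n)
      (λ k≤l (m , q) → anti C k≤l m , Q-anti k≤l q)
      (λ (m , q) (m′ , q′) → add C m m′ , Q-add m q q′)
      Q-ramsey ,
    mk≼ (λ k → k , proj₁ ∘ toWitness) , proj₂ ∘ toWitness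

  module Fusion (C : ℕ → Condition S) (step : ∀ i → C (suc i) ≼ C i) where

    descend : ∀ {i j} → i ≤ j → C j ≼ C i
    descend {j = zero}  z≤n = ≼-refl {C 0}
    descend {j = suc j} i≤j with m≤n⇒m<n∨m≡n i≤j
    ... | inj₁ (s≤s i≤j′) = ≼-trans (step j) (descend i≤j′)
    ... | inj₂ refl       = ≼-refl {C (suc j)}

    Meet : ℕ → ℕ → Set
    Meet k n = ∀ {i} → i ≤ k → _∋_ (C i) k n

    common : ∀ k → ∃[ l ] (∀ {n} → _∋_ (C k) l n → Meet k n)
    common k = proj₁ bound , λ m {i} i≤k →
      let j = fromℕ< (s≤s i≤k) in
      subst (λ i → _∋_ (C i) k _) (toℕ-fromℕ< (s≤s i≤k))
        (proj₂ (lev j) (anti (C k) (proj₂ bound j) m))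
      where
      lev : ∀ (j : Fin (suc k)) → ∃[ l ] (∀ {n} → _∋_ (C k) l n → _∋_ (C (toℕ j)) k n)
      lev j = refine (descend (s≤s⁻¹ (toℕ<n j))) k
      bound = upperBound (proj₁ ∘ lev)

    -- Level `k` meets only the first `k + 1` conditions, hence contains a level of `C k` and is
    -- Ramsey. From level `i` on it lies in `C i`.
    fusion : Condition S
    fusion = build Meet
      (λ {k} {l} k≤l p {i} i≤k → anti (C i) k≤l (p (≤-trans i≤k k≤l)))
      (λ {k} {x} p q {i} i≤k → add (C i) (p i≤k) (q (≤-trans i≤k (m≤m+n k x))))
      (λ k → Ramsey-mono S (proj₂ (common k)) (ramsey (C k) _))

    fusion-≼ : ∀ i → fusion ≼ C i
    fusion-≼ i = mk≼ λ k → k ⊔ i , λ m → anti (C i) (m≤m⊔n k i) (toWitness m (m≤n⊔m k i))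

  -- Limits of shifts and the Ellis argument.

  module _ {r : ℕ} where

    record Lim (C : Condition S) (z y : ℕ → Fin r) : Set where
      constructor mkLim
      field
        visits : ∀ k → Ramsey S (λ n → _∋_ C k n × Agree k (shift n z) y)
    open Lim

    -- Some limit of shifts of z along C lies in the cylinder kc, a pair of a length and the
    -- number of a prefix.  Only countably many cylinders have to be treated in `minimal`
    -- and `recurrent`.
    record Has (C : Condition S) (z : ℕ → Fin r) (kc : ℕ × ℕ) : Set where
      constructor mkHas
      field
        meets : ∀ l → Ramsey S (λ n → _∋_ C l n × toℕ (prefix (proj₁ kc) (shift n z)) ≡ proj₂ kc)
    open Has

    Has-mono : ∀ {C D z kc} → D ≼ C → Has D z kc → Has C z kc
    Has-mono D≼C has = mkHas λ l → let (l′ , D⊆C) = refine D≼C l in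
      Ramsey-mono S (λ (m , e) → D⊆C m , e) (meets has l′)

    Lim⇒Has : ∀ {C z y} → Lim C z y → ∀ k → Has C z (k , toℕ (prefix k y))
    Lim⇒Has {C} lim k = mkHas λ l → Ramsey-mono S
      (λ (m , e) → anti C (m≤n⊔m k l) m ,
        cong toℕ (prefix-≡ k λ i<k → e (≤-trans i<k (m≤m⊔n k l))))
      (visits lim (k ⊔ l))

    Has⇒Lim : ∀ {C z y} → (∀ k → Has C z (k , toℕ (prefix k y))) → Lim C z y
    Has⇒Lim {z = z} {y} has = mkLim λ k → Ramsey-mono S
      (λ {n} (m , e) → m , λ {i} → prefix-agree k (shift n z) y (toℕ-injective e)) (meets (has k) k)

    -- Here addition enters. The image `w` for the limit `x` of `y` has entries at most `N`; `w′` is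
    -- taken from level `k + N`, deep enough to be added to any entry of `w`. The sums are again an
    -- image.
    Lim-trans : ∀ {C z y x} → Lim C z y → Lim C y x → Lim C z x
    Lim-trans {C} {z} {y} {x} zy yx = mkLim λ k → mkRamsey λ r′ →
      let (N , M , mono) = double S S (visits yx k) (λ N → visits zy (k + N)) r′
      in N + M , λ χ →
      let (w , w′ , im , im′ , in-X , in-Y , ≤N , ≤M , const) = mono (λ a b → χ (a + b)) in
      (λ j → w j + w′ j) , Image-+ im im′ ,
      (λ j → add C (proj₁ (in-X j)) (anti C (+-monoʳ-≤ k (≤N j)) (proj₁ (in-Y j))) ,
        shift-agree z y x (proj₂ (in-X j)) λ i< → proj₂ (in-Y j) (<-≤-trans i< (+-monoʳ-≤ k (≤N j)))) ,
      (λ j → +-mono-≤ (≤N j) (≤M j)) , λ j → const j j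

    Lim-closed : ∀ {C z x} (y : ℕ → ℕ → Fin r) →
      (∀ k → ∃[ n ] Lim C z (y n) × Agree k (y n) x) → Lim C z x
    Lim-closed y near = mkLim λ k → let (n , lim , agree) = near k in
      Ramsey-mono S (λ (m , e) → m , λ i<k → trans (e i<k) (agree i<k)) (visits lim k)

    -- For each `k`, some prefix of length `k` is shared by the shifts of `z` over a Ramsey part of
    -- level `k`. A cluster point of these prefixes is a limit.
    Lim-exists : ∀ C z → Σ[ y ∈ (ℕ → Fin r) ] Lim C z y
    Lim-exists C z = proj₁ cl , mkLim λ k →
      let (n , k≤n , agree) = proj₂ cl k in
      Ramsey-mono S
        (λ {p} (m , e) → anti C k≤n m , λ {i} i<k → trans
          (prefix-agree n (shift p z) (approx n) (trans e (sym (approx-prefix n))) (≤-trans i<k k≤n))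
          (agree i<k))
        (proj₂ (part n))
      where
      part : ∀ k → ∃[ l ] Ramsey S (λ n → _∋_ C k n × prefix k (shift n z) ≡ l)
      part k = Ramsey-partition (ramsey C k) (λ n → prefix k (shift n z))
      element : ∀ k → ∃[ n ] prefix k (shift n z) ≡ proj₁ (part k)
      element k = let (w , _ , in-X , _) = proj₂ (Ramsey.find (proj₂ (part k)) 1) (λ _ → zero)
                  in w base , proj₂ (in-X base)
      approx : ℕ → ℕ → Fin r
      approx k = shift (proj₁ (element k)) z
      approx-prefix : ∀ k → prefix k (approx k) ≡ proj₁ (part k)
      approx-prefix k = proj₂ (element k)
      cl = cluster approx

    Minimal : Condition S → (ℕ → Fin r) → Set
    Minimal M c = ∀ {E} → E ≼ M → ∀ {y} → Lim M c y → Lim E c y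

    -- Stage `i` passes to a refinement without limits of `z` in cylinder `i`, when there is one. If
    -- a refinement of the fusion lost the limit `y`, it would miss a cylinder around `y`; that
    -- cylinder would have been removed at its stage, contradicting that `y` is a limit along the
    -- fusion.
    minimal : ∀ C z → Σ[ D ∈ Condition S ] D ≼ C × Minimal D z
    minimal C z = fusion , fusion-≼ 0 , λ {E} E≼D {y} lim → Has⇒Lim λ k →
      decidable-stable em λ ¬has →
        let (i , eq) = unpair-surjective k (toℕ (prefix k y)) in
        avoid i (subst (λ kc → Has fusion z kc) (sym eq) (Lim⇒Has lim k))
          (E , ≼-trans E≼D (fusion-≼ i) , subst (λ kc → ¬ Has E z kc) (sym eq) ¬has)
      where
      Smaller : Condition S → ℕ × ℕ → Set
      Smaller C kc = Σ[ E ∈ Condition S ] E ≼ C × ¬ Has E z kc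
      shrink : (C : Condition S) → ∀ {kc} → Dec (Smaller C kc) → Condition S
      shrink C (yes (E , _)) = E
      shrink C (no _)        = C
      chain : ℕ → Condition S
      chain zero    = C
      chain (suc i) = shrink (chain i) (em {Smaller (chain i) (unpair i)})
      step : ∀ i → chain (suc i) ≼ chain i
      step i with em {Smaller (chain i) (unpair i)}
      ... | yes (E , E≼ , _) = E≼
      ... | no _             = ≼-refl {chain i}
      open Fusion chain step
      avoid′ : ∀ i → Smaller (chain i) (unpair i) → ¬ Has (chain (suc i)) z (unpair i)
      avoid′ i s with em {Smaller (chain i) (unpair i)}
      ... | yes (_ , _ , ¬has) = ¬has
      ... | no ¬s              = contradiction s ¬s
      avoid : ∀ i → Has fusion z (unpair i) → ¬ Smaller (chain i) (unpair i)
      avoid i has s = avoid′ i s (Has-mono (fusion-≼ (suc i)) has)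

    -- The counterpart of `minimal` in which the colouring moves and `C` stays: stage `i` passes to
    -- a limit whose own limits miss cylinder `i`, when there is one. By transitivity `y` is a limit
    -- of every stage, so no cylinder around `y` can be missed by the limits of `y`.
    recurrent : ∀ C z → Σ[ y ∈ (ℕ → Fin r) ] Lim C z y × Lim C y y
    recurrent C z = y , Lim-trans (inChain∞ 0) lim , Has⇒Lim λ k →
      decidable-stable em λ ¬has →
        let (i , eq) = unpair-surjective k (toℕ (prefix k y)) in
        avoid i
          (y , Lim-trans (inChain∞ i) lim , subst (λ kc → ¬ Has C y kc) (sym eq) ¬has)
          (subst (Has C (chain (suc i))) (sym eq) (Lim⇒Has (Lim-trans (inChain∞ (suc i)) lim) k))
      where
      Fewer : (ℕ → Fin r) → ℕ × ℕ → Set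
      Fewer z kc = Σ[ y ∈ (ℕ → Fin r) ] Lim C z y × ¬ Has C y kc
      shrink : (z : ℕ → Fin r) → ∀ {kc} → Dec (Fewer z kc) → ℕ → Fin r
      shrink z (yes (y , _)) = y
      shrink z (no _)        = proj₁ (Lim-exists C z)
      chain : ℕ → ℕ → Fin r
      chain zero    = z
      chain (suc i) = shrink (chain i) (em {Fewer (chain i) (unpair i)})
      step : ∀ i → Lim C (chain i) (chain (suc i))
      step i with em {Fewer (chain i) (unpair i)}
      ... | yes (_ , l , _) = l
      ... | no _            = proj₂ (Lim-exists C (chain i))
      avoid : ∀ i → Fewer (chain i) (unpair i) → ¬ Has C (chain (suc i)) (unpair i)
      avoid i s with em {Fewer (chain i) (unpair i)}
      ... | yes (_ , _ , ¬has) = ¬has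
      ... | no ¬s              = contradiction s ¬s
      inChain : ∀ {i j} → i < j → Lim C (chain i) (chain j)
      inChain {i} {suc j} (s≤s i≤j) with m≤n⇒m<n∨m≡n i≤j
      ... | inj₁ i<j  = Lim-trans (inChain i<j) (step j)
      ... | inj₂ refl = step j
      cl = cluster chain
      inChain∞ : ∀ i → Lim C (chain i) (proj₁ cl)
      inChain∞ i = Lim-closed chain λ k →
        let (n , k≤n , agree) = proj₂ cl (k ⊔ suc i) in
        n , inChain (≤-trans (m≤n⊔m k (suc i)) k≤n) , λ i<k → agree (≤-trans i<k (m≤m⊔n k (suc i)))
      y   = proj₁ (Lim-exists C (proj₁ cl))
      lim = proj₂ (Lim-exists C (proj₁ cl))

    stabilise : ∀ {M y} → Lim M y y →
      Σ[ D ∈ Condition S ] D ≼ M × (∀ {k n} → _∋_ D k n → Agree k (shift n y) y)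
    stabilise {M} {y} rec = restrict M (λ k n → Agree k (shift n y) y)
      (λ k≤l e i<k → e (≤-trans i<k k≤l))
      (λ _ e e′ → shift-agree y y y e e′)
      (visits rec)

    confine : ∀ {M c y} → Lim M c y → (∀ {k n} → _∋_ M k n → Agree k (shift n y) y) →
      Σ[ D ∈ Condition S ] D ≼ M × (∀ {k n} → _∋_ D k n → Agree k (shift n c) y)
    confine {M} {c} {y} lim stab = restrict M (λ k n → Agree k (shift n c) y)
      (λ k≤l e i<k → e (≤-trans i<k k≤l))
      (λ m _ e′ → shift-agree c y y (stab m) e′)
      (visits lim)

    settle : ∀ {M c} → Minimal M c → (Σ[ y ∈ (ℕ → Fin r) ] Lim M c y × Lim M y y) →
      Σ[ D ∈ Condition S ] D ≼ M × ∃[ l ] ∃[ k ] (∀ {n} → _∋_ D k n → c n ≡ l)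
    settle {M} {c} least (y , lim , rec) with stabilise rec
    -- Minimality keeps `y` a limit of `c` along `Stab`, which is what makes the confined levels
    -- Ramsey.
    ... | Stab , Stab≼M , stab with confine (least Stab≼M lim) stab
    ... | D , D≼Stab , ret = D , ≼-trans D≼Stab Stab≼M ,
      -- The colour of `n` is place 0 of the shift of `c` by `n`; level 1 is the first that controls
      -- this place.
      y 0 , 1 , λ {n} m → trans (cong c (sym (+-identityʳ n))) (ret m (s≤s z≤n))

    abstract
      decide : ∀ C (c : ℕ → Fin r) → Σ[ D ∈ Condition S ] D ≼ C × ∃[ l ] ∃[ k ] (∀ {n} → _∋_ D k n → c n ≡ l)
      decide C c = refineTo (minimal C c)
        where
        refineTo : Σ[ M ∈ Condition S ] M ≼ C × Minimal M c →
          Σ[ D ∈ Condition S ] D ≼ C × ∃[ l ] ∃[ k ] (∀ {n} → _∋_ D k n → c n ≡ l)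
        refineTo (M , M≼C , least) =
          let (D , D≼M , const) = settle least (recurrent M c) in D , ≼-trans D≼M M≼C , const

    -- Iterated multiplicative limits.

    decideAll : ∀ C (c : ℕ → ℕ → Fin r) → Σ[ D ∈ Condition S ] D ≼ C ×
      (∀ a → ∃[ l ] ∃[ k ] (∀ {n} → _∋_ D k n → c a n ≡ l))
    decideAll C c = fusion , fusion-≼ 0 , λ a →
      let (l , k , const) = proj₂ (proj₂ (decide (chain a) (c a)))
          (k′ , ⊆) = refine (fusion-≼ (suc a)) k
      in l , k′ , const ∘ ⊆
      where
      chain : ℕ → Condition S
      chain zero    = C
      chain (suc a) = proj₁ (decide (chain a) (c a))
      open Fusion chain (λ a → proj₁ (proj₂ (decide (chain a) (c a))))

    Limits : Condition S → (c c′ : ℕ → Fin r) → Set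
    Limits D c c′ = ∀ a → ∃[ k ] (∀ {n} → _∋_ D k n → c (a * n) ≡ c′ a)

    -- `c′ a` is the iterated limit of `c (a * n₁ * ... * n_m)`, the innermost limit being over the
    -- last factor.
    Iterated : Condition S → ℕ → (c c′ : ℕ → Fin r) → Set
    Iterated D zero    c c′ = ∀ a → c a ≡ c′ a
    Iterated D (suc m) c c′ = Σ[ c₁ ∈ (ℕ → Fin r) ] Iterated D m c c₁ × Limits D c₁ c′

    Iterated-mono : ∀ {D E} m {c c′} → E ≼ D → Iterated D m c c′ → Iterated E m c c′
    Iterated-mono zero    E≼D it = it
    Iterated-mono {D} {E} (suc m) E≼D (c₁ , it , lims) = c₁ , Iterated-mono {D} {E} m E≼D it , λ a →
      let (k , const) = lims a ; (l , ⊆) = refine E≼D k in l , const ∘ ⊆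

    iterate : ∀ C m c → Σ[ D ∈ Condition S ] Σ[ c′ ∈ (ℕ → Fin r) ] Iterated D m c c′
    iterate C zero    c = C , c , λ _ → refl
    iterate C (suc m) c with iterate C m c
    ... | D , c₁ , it with decideAll D (λ a n → c₁ (a * n))
    ... | E , E≼D , const = E , proj₁ ∘ const , c₁ , Iterated-mono {D} {E} m E≼D it , proj₂ ∘ const

-- Products of images and of finite sums.

open FiniteNonempty using (elements; increasing; max; min; ∑)

module Blocks (em : ExcludedMiddle 0ℓ) (S : Shape) where
  open Conditions em S
  open Shape S
  open Condition

  module _ (D : Condition S) where

    -- The argument `a` carries the product of the factors already passed, and `h` turns it into the
    -- depth demanded of the next one.
    Admissible : (ℕ → ℕ) → ℕ → ∀ {m} → (Fin m → ℕ) → Set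
    Admissible h a {zero}  n = ⊤
    Admissible h a {suc m} n = _∋_ D (h a) (n zero) × Admissible h (a * n zero) (n ∘ suc)

    Admissible-≤ : ∀ {g h} → (∀ a → g a ≤ h a) → ∀ m {n : Fin m → ℕ} {a} → Admissible h a n → Admissible g a n
    Admissible-≤ g≤h zero    _         = tt
    Admissible-≤ g≤h (suc m) (p , adm) = anti D (g≤h _) p , Admissible-≤ g≤h m adm

    blocks : ∀ {r} m {c c′ : ℕ → Fin r} → Iterated D m c c′ →
      Σ[ h ∈ (ℕ → ℕ) ] (∀ {n : Fin m → ℕ} {a} → Admissible h a n → c (a * ∏ n) ≡ c′ a)
    blocks zero {c} it = (λ _ → 0) , λ {_} {a} _ → trans (cong c (*-identityʳ a)) (it a)
    blocks (suc m) {c} (c₁ , it , lims) with blocks m it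
    ... | h , eq = (λ a → proj₁ (lims a) ⊔ h a) , λ {n} {a} (p , adm) →
      trans (cong c (sym (*-assoc a (n zero) (∏ (n ∘ suc)))))
        (trans (eq (Admissible-≤ (λ a → m≤n⊔m (proj₁ (lims a)) (h a)) m adm))
          (proj₂ (lims a) (anti D (m≤m⊔n _ (h a)) p)))

    module _ (h : ℕ → ℕ) where

      -- Bounding partial products by `G` bounds the required depth by `K`, so a single image at
      -- level `K` serves for all choices of earlier entries.
      images : ∀ m G → Σ[ w ∈ (Fin m → Index → ℕ) ] (∀ i → Image (w i)) ×
        (∀ {a} → a ≤ G → (f : Fin m → Index) → Admissible h a (λ i → w i (f i)))
      images zero    G = (λ ()) , (λ ()) , λ _ _ → tt
      images (suc m) G with upperBound≤ h G
      ... | K , h≤K with Ramsey.find (ramsey D K) 1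
      ... | N , mono with mono (λ _ → zero)
      ... | w , im , w∈ , w≤N , _ with images m (G * N)
      ... | ws , ims , adm = w ∷ᵛ ws , (λ { zero → im ; (suc i) → ims i }) , λ a≤G f →
        anti D (h≤K a≤G) (w∈ (f zero)) , adm (*-mono-≤ a≤G (w≤N (f zero))) (f ∘ suc)

      element : ∀ k → ∃[ n ] _∋_ D k n × NonZero n
      element k = let (w , im , w∈ , _) = proj₂ (Ramsey.find (ramsey D k) 1) (λ _ → zero)
                  in w base , w∈ base , positive im base

      -- Level and size at stage `t`. The size is the product of `1 + z s` over `s < t`, a bound for
      -- the partial products formed so far. The level dominates `h` up to that size, and grows by
      -- at least `z t` so that `add` applies.
      state : ℕ → ℕ × ℕ
      state zero    = proj₁ (upperBound≤ h 1) , 1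
      state (suc t) = let (N , Q) = state t ; z = proj₁ (element N) ; Q′ = Q * suc z in
        (N + z) ⊔ proj₁ (upperBound≤ h Q′) , Q′

      level size z : ℕ → ℕ
      level t = proj₁ (state t)
      size  t = proj₂ (state t)
      z     t = proj₁ (element (level t))

      z-member : ∀ t → _∋_ D (level t) (z t)
      z-member t = proj₁ (proj₂ (element (level t)))

      z-positive : ∀ t → NonZero (z t)
      z-positive t = proj₂ (proj₂ (element (level t)))

      h≤level : ∀ t {a} → a ≤ size t → h a ≤ level t
      h≤level zero    a≤ = proj₂ (upperBound≤ h 1) a≤
      h≤level (suc t) a≤ = ≤-trans (proj₂ (upperBound≤ h (size (suc t))) a≤) (m≤n⊔m (level t + z t) _)

      ascend : ∀ {f : ℕ → ℕ} → (∀ t → f t ≤ f (suc t)) → ∀ {s t} → s ≤ t → f s ≤ f t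
      ascend step {t = zero}  z≤n = ≤-refl
      ascend step {t = suc t} s≤t with m≤n⇒m<n∨m≡n s≤t
      ... | inj₁ (s≤s s≤t′) = ≤-trans (ascend step s≤t′) (step t)
      ... | inj₂ refl       = ≤-refl

      level-step : ∀ t → level t + z t ≤ level (suc t)
      level-step t = m≤m⊔n _ _

      level-mono : ∀ {s t} → s ≤ t → level s ≤ level t
      level-mono = ascend λ t → ≤-trans (m≤m+n _ _) (level-step t)

      size-mono : ∀ {s t} → s ≤ t → size s ≤ size t
      size-mono = ascend λ t → m≤m*n (size t) (suc (z t))

      -- Add from the smallest index: the remaining sum lies at level `t′`, which is at least
      -- `level t + z t`.
      sum-member : ∀ t ts → AllPairs _<_ (t ∷ ts) → _∋_ D (level t) (sum (map z (t ∷ ts)))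
      sum-member t []        _                       = subst (_∋_ D (level t)) (sym (+-identityʳ (z t))) (z-member t)
      sum-member t (t′ ∷ ts) ((t<t′ ∷ _) ∷ incr) = add D (z-member t)
        (anti D (≤-trans (level-step t) (level-mono t<t′)) (sum-member t′ ts incr))

      -- Rests on `1 + z t + σ ≤ (1 + z t) * (1 + σ)`. Thus a partial product extended by a block
      -- sum stays below the size just after the block.
      sum-bound : ∀ t ts → AllPairs _<_ (t ∷ ts) →
        size t * suc (sum (map z (t ∷ ts))) ≤ size (suc (foldr₁ _⊔_ (t ∷⁺ ts)))
      sum-bound t []        _                   = ≤-reflexive (cong (λ s → size t * suc s) (+-identityʳ (z t)))
      sum-bound t (t′ ∷ ts) ((t<t′ ∷ _) ∷ incr) = begin
        size t * suc (z t + σ)          ≤⟨ *-monoʳ-≤ (size t) (s≤s (+-monoʳ-≤ (z t) (m≤m+n σ (z t * σ)))) ⟩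
        size t * suc (z t + (σ + z t * σ)) ≡⟨ cong (size t *_) expand ⟩
        size t * (suc (z t) * suc σ)    ≡⟨ *-assoc (size t) (suc (z t)) (suc σ) ⟨
        size (suc t) * suc σ            ≤⟨ *-monoˡ-≤ (suc σ) (size-mono t<t′) ⟩
        size t′ * suc σ                 ≤⟨ sum-bound t′ ts incr ⟩
        size (suc (foldr₁ _⊔_ (t′ ∷⁺ ts))) ≤⟨ size-mono (s≤s (m≤n⊔m t _)) ⟩
        size (suc (t ⊔ foldr₁ _⊔_ (t′ ∷⁺ ts))) ∎
        where
        open ≤-Reasoning
        σ = sum (map z (t′ ∷ ts))
        expand : suc (z t + (σ + z t * σ)) ≡ suc (z t) * suc σ
        expand = cong suc (trans (sym (+-assoc (z t) σ _)) (trans (cong (_+ z t * σ) (+-comm (z t) σ))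
          (trans (+-assoc σ (z t) _) (cong (λ s → σ + s) (sym (*-suc (z t) σ))))))

      min≤head : ∀ t ts → foldr₁ _⊓_ (t ∷⁺ ts) ≤ t
      min≤head t []       = ≤-refl
      min≤head t (_ ∷ ts) = m⊓n≤m t _

      Increasing : ∀ {m} → (Fin m → FiniteNonempty) → Set
      Increasing {m} F = ∀ (i j : Fin m) → toℕ j ≡ suc (toℕ i) → max (F i) < min (F j)

      -- Induction over blocks, `s` passing to one more than the maximum of the block just used. The
      -- bound on the first block is quantified over `i` because `Fin m` may be empty.
      sums-admissible : ∀ m (F : Fin m → FiniteNonempty) → Increasing F → ∀ s {a} → a ≤ size s →
        (∀ i → toℕ i ≡ 0 → s ≤ min (F i)) → Admissible h a (λ i → ∑ (F i) z)
      sums-admissible zero    F incr s a≤ s≤min = tt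
      sums-admissible (suc m) F incr s {a} a≤ s≤min
        with F zero | s≤min zero refl | (λ i eq → incr zero (suc i) (cong suc eq))
      ... | record { elements = t ∷⁺ ts ; increasing = t< } | s≤ | before =
        anti D (h≤level t a≤t) (sum-member t ts t<) ,
        sums-admissible m (F ∘ suc) (λ i j eq → incr (suc i) (suc j) (cong suc eq)) _
          (≤-trans (*-mono-≤ a≤t (n≤1+n _)) (sum-bound t ts t<)) before
        where
        a≤t : a ≤ size t
        a≤t = ≤-trans a≤ (size-mono (≤-trans s≤ (min≤head t ts)))

      ∑-positive : ∀ F → NonZero (∑ F z)
      ∑-positive F with FiniteNonempty.elements F
      ... | t ∷⁺ ts = >-nonZero (≤-trans (>-nonZero⁻¹ (z t) {{z-positive t}}) (m≤m+n (z t) _))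

  products-and-sums : Ramsey S (λ _ → ⊤) → ∀ {r} m (c : ℕ → Fin r) →
    ∃[ l ]
    Σ[ w ∈ (Fin m → Index → ℕ) ] (∀ i → Image (w i)) ×
      (∀ (f : Fin m → Index) → c (∏ λ i → w i (f i)) ≡ l) ×
    Σ[ z ∈ (ℕ → ℕ) ] (∀ t → NonZero (z t)) × (∀ F → NonZero (∑ F z)) ×
      (∀ (F : Fin m → FiniteNonempty) → (∀ i j → toℕ j ≡ suc (toℕ i) → max (F i) < min (F j)) →
        c (∏ λ i → ∑ (F i) z) ≡ l)
  products-and-sums all m c with iterate (build (λ _ _ → ⊤) (λ _ _ → tt) (λ _ _ → tt) (λ _ → all)) m c
  ... | D , c′ , it with blocks D m it
  ... | h , eq with images D h m 1
  -- The same `h` governs images and sums, and both start from the empty product 1, so they share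
  -- the colour `c′ 1`.
  ... | w , im , adm = c′ 1 , w , im ,
    (λ f → trans (cong c (sym (*-identityˡ _))) (eq (adm ≤-refl f))) ,
    z D h , z-positive D h , ∑-positive D h ,
    λ F incr → trans (cong c (sym (*-identityˡ _)))
      (eq (sums-admissible D h m F incr 0 ≤-refl (λ _ _ → z≤n)))

-- Sums and multiples of matrix images.

toℚᵘ-ι : ∀ n → toℚᵘ (ι n) ≃ mkℚᵘ (+ n) 0
toℚᵘ-ι n = toℚᵘ-fromℚᵘ (mkℚᵘ (+ n) 0)

ι-+ : ∀ a b → ι (a + b) ≡ ι a +ℚ ι b
ι-+ a b = toℚᵘ-injective (begin
  toℚᵘ (ι (a + b))                   ≈⟨ toℚᵘ-ι (a + b) ⟩
  mkℚᵘ (+ (a + b)) 0                 ≈⟨ *≡* (cong (ℤ._* + 1) (sym (cong₂ ℤ._+_ (ℤ.*-identityʳ (+ a)) (ℤ.*-identityʳ (+ b))))) ⟩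
  mkℚᵘ (+ a) 0 ℚᵘ.+ mkℚᵘ (+ b) 0     ≈⟨ ℚᵘ.+-cong (toℚᵘ-ι a) (toℚᵘ-ι b) ⟨
  toℚᵘ (ι a) ℚᵘ.+ toℚᵘ (ι b)         ≈⟨ toℚᵘ-homo-+ (ι a) (ι b) ⟨
  toℚᵘ (ι a +ℚ ι b)                  ∎)
  where open ℚᵘ.≃-Reasoning

ι-* : ∀ a b → ι (a * b) ≡ ι a *ℚ ι b
ι-* a b = toℚᵘ-injective (begin
  toℚᵘ (ι (a * b))                   ≈⟨ toℚᵘ-ι (a * b) ⟩
  mkℚᵘ (+ (a * b)) 0                 ≈⟨ *≡* (cong (ℤ._* + 1) (ℤ.pos-* a b)) ⟩
  mkℚᵘ (+ a) 0 ℚᵘ.* mkℚᵘ (+ b) 0     ≈⟨ ℚᵘ.*-cong (toℚᵘ-ι a) (toℚᵘ-ι b) ⟨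
  toℚᵘ (ι a) ℚᵘ.* toℚᵘ (ι b)         ≈⟨ toℚᵘ-homo-* (ι a) (ι b) ⟨
  toℚᵘ (ι a *ℚ ι b)                  ∎)
  where open ℚᵘ.≃-Reasoning

·-+ : ∀ {u v} (A : Matrix u v) x y i → (A · λ j → x j + y j) i ≡ (A · x) i +ℚ (A · y) i
·-+ A x y i = trans
  (sum-cong-≗ λ j → trans (cong (A i j *ℚ_) (ι-+ (x j) (y j))) (ℚ.*-distribˡ-+ (A i j) (ι (x j)) (ι (y j))))
  (∑-distrib-+ (λ j → A i j *ℚ ι (x j)) (λ j → A i j *ℚ ι (y j)))

·-* : ∀ {u v} (A : Matrix u v) a x i → (A · λ j → a * x j) i ≡ ι a *ℚ (A · x) i
·-* A a x i = trans
  (sum-cong-≗ λ j → trans (cong (A i j *ℚ_) (ι-* a (x j))) (swap (A i j) (ι a) (ι (x j))))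
  (sym (*-distribˡ-sum (ι a) (λ j → A i j *ℚ ι (x j))))
  where
  swap : ∀ p q s → p *ℚ (q *ℚ s) ≡ q *ℚ (p *ℚ s)
  swap p q s = trans (sym (ℚ.*-assoc p q s)) (trans (cong (_*ℚ s) (ℚ.*-comm p q)) (ℚ.*-assoc q p s))

ImageOf : ∀ {u v} → Matrix u v → Vector ℕ u → Set
ImageOf {u} {v} A w = Σ[ x ∈ Vector ℕ v ] x ∈ ℕ₊ ^ᵛ v × (A · x) ≈ι w × w ∈ ℕ₊ ^ᵛ u

+-nonZeroˡ : ∀ {a b} → NonZero a → NonZero (a + b)
+-nonZeroˡ {suc _} _ = _

*-nonZero : ∀ {a b} → NonZero a → NonZero b → NonZero (a * b)
*-nonZero {a} {b} a≢0 b≢0 = m*n≢0 a b {{a≢0}} {{b≢0}}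

∏-nonZero : ∀ m {n : Fin m → ℕ} → (∀ i → NonZero (n i)) → NonZero (∏ n)
∏-nonZero zero    _   = _
∏-nonZero (suc m) n≢0 = *-nonZero (n≢0 zero) (∏-nonZero m (n≢0 ∘ suc))

ImageOf-+ : ∀ {u v} (A : Matrix u v) {w w′} → ImageOf A w → ImageOf A w′ → ImageOf A (λ j → w j + w′ j)
ImageOf-+ A {w} {w′} (x , x≢0 , Ax≈w , w≢0) (y , _ , Ay≈w′ , _) =
  (λ j → x j + y j) , (λ j → +-nonZeroˡ (x≢0 j)) ,
  (λ i → trans (·-+ A x y i) (trans (cong₂ _+ℚ_ (Ax≈w i) (Ay≈w′ i)) (sym (ι-+ (w i) (w′ i))))) ,
  λ j → +-nonZeroˡ (w≢0 j)

ImageOf-* : ∀ {u v} (A : Matrix u v) {w w′ a} → NonZero a → (∀ j → w′ j ≡ a * w j) → ImageOf A w → ImageOf A w′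
ImageOf-* A {w} {w′} {a} a≢0 w′≡ (x , x≢0 , Ax≈w , w≢0) =
  (λ j → a * x j) , (λ j → *-nonZero a≢0 (x≢0 j)) ,
  (λ i → trans (·-* A a x i) (trans (cong (ι a *ℚ_) (Ax≈w i))
    (trans (sym (ι-* a (w i))) (cong ι (sym (w′≡ i)))))) ,
  λ j → subst NonZero (sym (w′≡ j)) (*-nonZero a≢0 (w≢0 j))

matrixShape : ∀ {u v} → Matrix u v → Fin u → Shape
matrixShape {u} A j₀ = record
  { Index    = Fin u
  ; base     = j₀
  ; Image    = ImageOf A
  ; Image-+  = ImageOf-+ A
  ; positive = λ (_ , _ , _ , w≢0) → w≢0
  }

-- One family `w` holds an image of every `A i`, so its monochromaticity gives all of them the same
-- colour.
jointShape : ∀ {m} {u v : Fin m → ℕ} → (∀ i → Matrix (u i) (v i)) → (i₀ : Fin m) → Fin (u i₀) → Shape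
jointShape {m} {u} A i₀ j₀ = record
  { Index    = Σ (Fin m) (Fin ∘ u)
  ; base     = i₀ , j₀
  ; Image    = λ w → ∀ i → ImageOf (A i) (λ j → w (i , j))
  ; Image-+  = λ im im′ i → ImageOf-+ (A i) (im i) (im′ i)
  ; positive = λ im (i , j) → proj₂ (proj₂ (proj₂ (im i))) j
  }

-- The Ramsey property of joint images.

module _ (em : ExcludedMiddle 0ℓ) where
  open Classical em

  -- Compactness: a cluster point of bad colourings has a monochromatic image, and a bad colouring
  -- that agrees with it on that image is not bad.
  matrix-ramsey : ∀ {u v} (A : Matrix u v) → ImagePartitionRegular A → ∀ j₀ →
    Ramsey (matrixShape A j₀) (λ _ → ⊤)
  matrix-ramsey A regular j₀ = mkRamsey λ r → decidable-stable em λ none →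
    let bad : ∀ N → Σ[ χ ∈ (ℕ → Fin r) ] ¬ Mono (matrixShape A j₀) (λ _ → ⊤) N χ
        bad N = ¬∀⇒∃¬ λ all → none (N , all)
        (χ , near) = cluster (proj₁ ∘ bad)
        (x , x≢0 , k , w , w∈ , Ax≈w) = regular χ
        (N , w≤N) = upperBound w
        (n , N<n , agree) = near (suc N)
        colour : ∀ j → proj₁ (bad n) (w j) ≡ k
        colour j = trans (agree (s≤s (w≤N j))) (proj₂ (w∈ j))
    in proj₂ (bad n)
      (w , (x , x≢0 , Ax≈w , proj₁ ∘ w∈) , _ , (λ j → ≤-trans (w≤N j) (<⇒≤ N<n)) ,
       λ j → trans (colour j) (sym (colour j₀)))

  -- Apply `double` to `χ (a * b)`: the image of the first matrix is scaled by one entry of the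
  -- joint image of the others, and that joint image by one entry of the first. All these products
  -- have one colour.
  joint-ramsey : ∀ m {u v : Fin (suc m) → ℕ} (A : ∀ i → Matrix (u i) (v i)) →
    (∀ i → ImagePartitionRegular (A i)) → (j₀ : ∀ i → Fin (u i)) →
    Ramsey (jointShape A zero (j₀ zero)) (λ _ → ⊤)
  joint-ramsey zero A regular j₀ = mkRamsey λ r →
    let (N , mono) = Ramsey.find (matrix-ramsey (A zero) (regular zero) (j₀ zero)) r in
    N , λ χ → let (w , im , _ , w≤N , const) = mono χ in
      (λ { (zero , j) → w j }) , (λ { zero → im }) , _ ,
      (λ { (zero , j) → w≤N j }) , λ { (zero , j) → const j }
  joint-ramsey (suc m) A regular j₀ = mkRamsey λ r →
    let (N , M , mono) = double _ _
          (matrix-ramsey (A zero) (regular zero) (j₀ zero))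
          (λ _ → joint-ramsey m (A ∘ suc) (regular ∘ suc) (j₀ ∘ suc)) r
    in N * M , λ χ →
    let (w , w′ , im , im′ , _ , _ , w≤N , w′≤M , const) = mono (λ a b → χ (a * b))
        base  = j₀ zero
        base′ = zero , j₀ (suc zero)
    in (λ { (zero , j) → w j * w′ base′ ; (suc i , j) → w base * w′ (i , j) }) ,
       (λ { zero    → ImageOf-* (A zero) (proj₂ (proj₂ (proj₂ (im′ zero))) _) (λ j → *-comm (w j) _) im
          ; (suc i) → ImageOf-* (A (suc i)) (proj₂ (proj₂ (proj₂ im)) base) (λ _ → refl) (im′ i) }) , _ ,
       (λ { (zero , j) → *-mono-≤ (w≤N j) (w′≤M base′) ; (suc i , j) → *-mono-≤ (w≤N base) (w′≤M (i , j)) }) ,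
       λ { (zero , j) → const j base′ ; (suc i , j) → const base (i , j) }

-- Assembly of the vectors and the sequence.

nonZero⇒Fin : ∀ {n} → NonZero n → Fin n
nonZero⇒Fin {suc _} _ = zero

theorem3p17 : ExcludedMiddle 0ℓ →
    (r m : ℕ) → r ∈ ℕ₊ → m ∈ ℕ₊ →
    (E : Fin r → Pred ℕ 0ℓ) → ℕ₊ ≐ ⋃ (Fin r) E →
    (u v : Fin m → ℕ) → (∀ i → u i ∈ ℕ₊) → (∀ i → v i ∈ ℕ₊) →
    (A : ∀ i → Matrix (u i) (v i)) → (∀ i → ImagePartitionRegular (A i)) →
    Σ[ k ∈ Fin r ]
    Σ[ x ∈ (∀ i → Vector ℕ (v i)) ]
    Σ[ y ∈ (∀ i → Vector ℕ (v i)) ]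
    Σ[ z ∈ (ℕ → ℕ) ]
    (∀ i → x i ∈ ℕ₊ ^ᵛ v i) ×
    (∀ i → y i ∈ ℕ₊ ^ᵛ v i) ×
    (∀ t → t ∈ ℕ₊ → z t ∈ ℕ₊) ×
    (∀ i → (A i · x i) ∈ι E k) ×
    (Σ[ w ∈ (∀ i → Vector ℕ (u i)) ]
    (∀ i → w i ∈ ℕ₊ ^ᵛ u i) ×
    (∀ i → (A i · y i) ≈ι w i) ×
    P w ⊆ E k) ×
    PS m z ⊆ E k
theorem3p17 em r (suc m) r≢0 _ E (ℕ₊⊆⋃E , _) u v u≢0 _ A regular = k , x , y , z ,
  (λ i → proj₁ (proj₂ (scaled i))) ,
  (λ i → proj₁ (proj₂ (im i i))) ,
  (λ t _ → z≢0 t) ,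
  (λ i → (λ j → w zero (i , j) * R) ,
    -- Only the first factor varies; the others stay at `base` and multiply to `R`.
    (λ j → inClass (*-nonZero (w≢0 zero (i , j)) R≢0) (products λ { zero → i , j ; (suc _) → base })) ,
    proj₁ (proj₂ (proj₂ (scaled i)))) ,
  ((λ i j → w i (i , j)) ,
    (λ i j → w≢0 i (i , j)) ,
    (λ i → proj₁ (proj₂ (proj₂ (im i i)))) ,
    λ { (f , refl) → inClass (∏-nonZero (suc m) λ i → w≢0 i (i , f i)) (products λ i → i , f i) }) ,
  λ { (F , incr , refl) → inClass (∏-nonZero (suc m) λ i → ∑≢0 (F i)) (sums F incr) }
  where
  colour : ℕ → Fin r
  colour zero    = nonZero⇒Fin r≢0
  colour (suc n) = proj₁ (ℕ₊⊆⋃E {suc n} _)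

  inClass : ∀ {n l} → NonZero n → colour n ≡ l → n ∈ E l
  inClass {suc n} _ refl = proj₂ (ℕ₊⊆⋃E {suc n} _)

  j₀ : ∀ i → Fin (u i)
  j₀ i = nonZero⇒Fin (u≢0 i)

  S : Shape
  S = jointShape A zero (j₀ zero)

  open Shape S

  main = Blocks.products-and-sums em S (joint-ramsey em m A regular j₀) (suc m) colour

  k : Fin r
  k = proj₁ main
  w : Fin (suc m) → Index → ℕ
  w = proj₁ (proj₂ main)
  im : ∀ i → Image (w i)
  im = proj₁ (proj₂ (proj₂ main))
  products : ∀ (f : Fin (suc m) → Index) → colour (∏ λ i → w i (f i)) ≡ k
  products = proj₁ (proj₂ (proj₂ (proj₂ main)))
  rest = proj₂ (proj₂ (proj₂ (proj₂ main)))
  z : ℕ → ℕ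
  z = proj₁ rest
  z≢0 = proj₁ (proj₂ rest)
  ∑≢0 = proj₁ (proj₂ (proj₂ rest))
  sums = proj₂ (proj₂ (proj₂ rest))

  w≢0 : ∀ i j → NonZero (w i j)
  w≢0 i = positive (im i)

  R : ℕ
  R = ∏ λ i → w (suc i) base

  R≢0 : NonZero R
  R≢0 = ∏-nonZero m λ i → w≢0 (suc i) base

  scaled : ∀ i → ImageOf (A i) (λ j → w zero (i , j) * R)
  scaled i = ImageOf-* (A i) R≢0 (λ j → *-comm (w zero (i , j)) R) (im zero i)

  x y : ∀ i → Vector ℕ (v i)
  x i = proj₁ (scaled i)
  y i = proj₁ (im i i)
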